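{- Let $V$ be a finite set with $|V|\ge 2$ and let $A$ be a real symmetric matrix indexed by $V$. If $A$ has no self-contained pair of weighted chordless walks, then at least one of the following holds: (A) $A$ has a critical walk; (B) $A$ has two distinct simplicial vertices $u,v$ with $A_{uv}=\min A$.
   Context: $\min A=\min\{A_{xy}: x\ne y\in V\}$. An element $v\in V$ is simplicial in $A$ if $A_{yz}\ge\min\{A_{vy},A_{vz}\}$ for all distinct $y,z\in V\setminus\{v\}$. A walk is an ordered sequence $W=(v_0,\dots,v_p)$ ($p\ge1$) of elements of $V$; $V(W)=\{v_0,\dots,v_p\}$, $I(W)=\{v_1,\dots,v_{p-1}\}$ (internal elements); $W$ is closed if $v_0=v_p$. $W$ is weighted chordless in $A$ if $A_{v_{i-1}v_{i+1}}<\min\{A_{v_{i-1}v_i},A_{v_{i+1}v_i}\}$ for all $1\le i\le p-1$. A pair of walks $W_1,W_2$ is self-contained if $V(W_1)\cup V(W_2)=I(W_1)\cup I(W_2)$. A critical walk of $A$ is a closed weighted chordless walk $W=(v_0,\dots,v_p)$ whose end point $v_0$ is simplicial in $A$ and such that there is an internal element $u\in I(W)$ with $A_{v_0u}=\min A$. -}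

module Defs where

open import Data.Fin.Base using (Fin)
open import Data.List.Base using (List; []; _∷_; [_]; _++_)
open import Data.List.Membership.Propositional using (_∈_)
open import Data.Nat.Base using (ℕ)
open import Data.Product.Base using (_×_; _,_; proj₁; proj₂; ∃-syntax)
open import Data.Rational.Base as ℚ using (ℚ)
import Data.Rational.Properties as ℚ
open import Data.Sum.Base using (_⊎_; inj₁; inj₂)
open import Data.Unit.Base using (⊤)
open import Relation.Binary.PropositionalEquality using (_≡_; _≢_)
open import Relation.Nullary using (¬_)
open import Relation.Unary using (Pred; _∪_; _≐_)
open import Level using (0ℓ)

infix  4 _≤_ _<_ _≃_
infixl 7 _⊓_

-- Two-sided Dedekind cuts of ℚ, with _≃_ as the equality of reals.

record ℝ : Set₁ where
  field
    L U         : Pred ℚ 0ℓ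
    L-inhabited : ∃[ q ] L q
    U-inhabited : ∃[ q ] U q
    L-lower     : ∀ {q r} → q ℚ.< r → L r → L q
    U-upper     : ∀ {q r} → q ℚ.< r → U q → U r
    L-open      : ∀ {q} → L q → ∃[ r ] q ℚ.< r × L r
    U-open      : ∀ {r} → U r → ∃[ q ] q ℚ.< r × U q
    disjoint    : ∀ {q} → ¬ (L q × U q)
    located     : ∀ {q r} → q ℚ.< r → L q ⊎ U r

open ℝ

_≤_ : ℝ → ℝ → Set
x ≤ y = ∀ {q} → L x q → L y q

_<_ : ℝ → ℝ → Set
x < y = ∃[ q ] U x q × L y q

_≃_ : ℝ → ℝ → Set
x ≃ y = x ≤ y × y ≤ x

_⊓_ : ℝ → ℝ → ℝ
x ⊓ y = record
  { L           = λ q → L x q × L y q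
  ; U           = λ q → U x q ⊎ U y q
  ; L-inhabited = inhabited (L-inhabited x) (L-inhabited y)
  ; U-inhabited = proj₁ (U-inhabited x) , inj₁ (proj₂ (U-inhabited x))
  ; L-lower     = λ q<r (a , b) → L-lower x q<r a , L-lower y q<r b
  ; U-upper     = λ { q<r (inj₁ a) → inj₁ (U-upper x q<r a)
                    ; q<r (inj₂ b) → inj₂ (U-upper y q<r b) }
  ; L-open      = λ (a , b) → opened (L-open x a) (L-open y b)
  ; U-open      = λ { (inj₁ a) → let q , q<r , a′ = U-open x a in q , q<r , inj₁ a′
                    ; (inj₂ b) → let q , q<r , b′ = U-open y b in q , q<r , inj₂ b′ }
  ; disjoint    = λ { ((a , _) , inj₁ a′) → disjoint x (a , a′)
                    ; ((_ , b) , inj₂ b′) → disjoint y (b , b′) }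
  ; located     = λ q<r → locate (located x q<r) (located y q<r)
  }
  where
  down : ∀ z {q r} → q ℚ.≤ r → L z r → L z q
  down z q≤r Lr = let s , r<s , Ls = L-open z Lr in L-lower z (ℚ.≤-<-trans q≤r r<s) Ls

  inhabited : ∃[ q ] L x q → ∃[ q ] L y q → ∃[ q ] L x q × L y q
  inhabited (q , a) (r , b) =
    q ℚ.⊓ r , down x (ℚ.p⊓q≤p q r) a , down y (ℚ.p⊓q≤q q r) b

  opened : ∀ {q} → ∃[ r ] q ℚ.< r × L x r → ∃[ r ] q ℚ.< r × L y r →
           ∃[ r ] q ℚ.< r × (L x r × L y r)
  opened (r , q<r , a) (s , q<s , b) with ℚ.≤-total r s
  ... | inj₁ r≤s = r , q<r , a , down y r≤s b
  ... | inj₂ s≤r = s , q<s , down x s≤r a , b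

  locate : ∀ {q r} → L x q ⊎ U x r → L y q ⊎ U y r →
           (L x q × L y q) ⊎ (U x r ⊎ U y r)
  locate (inj₁ a) (inj₁ b) = inj₁ (a , b)
  locate (inj₂ a) _        = inj₂ (inj₁ a)
  locate (inj₁ _) (inj₂ b) = inj₂ (inj₂ b)

Matrix : ℕ → Set₁
Matrix n = Fin n → Fin n → ℝ

-- A walk (v₀ , … , vₚ) with p ≥ 1 is stored as v₀, the list v₁ … vₚ₋₁, and vₚ.

record Walk (V : Set) : Set where
  constructor walk
  field
    start    : V
    internal : List V
    end      : V

  vertices : List V
  vertices = start ∷ internal ++ [ end ]

  Closed : Set
  Closed = start ≡ end

open Walk

V[_] I[_] : ∀ {V} → Walk V → Pred V 0ℓ
V[ W ] x = x ∈ vertices W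
I[ W ] x = x ∈ internal W

SelfContained : ∀ {V} → Walk V → Walk V → Set
SelfContained W₁ W₂ = (V[ W₁ ] ∪ V[ W₂ ]) ≐ (I[ W₁ ] ∪ I[ W₂ ])

module _ {n : ℕ} where

  infix 4 _≃min_

  Symmetric : Matrix n → Set
  Symmetric A = ∀ x y → A x y ≃ A y x

  -- The real m is the minimum of the off-diagonal entries of A.
  _≃min_ : ℝ → Matrix n → Set
  m ≃min A = (∀ x y → x ≢ y → m ≤ A x y) × (∃[ x ] ∃[ y ] x ≢ y × m ≃ A x y)

  Simplicial : Matrix n → Fin n → Set
  Simplicial A v = ∀ y z → y ≢ v → z ≢ v → y ≢ z → A v y ⊓ A v z ≤ A y z

  ChordlessList : Matrix n → List (Fin n) → Set
  ChordlessList A (a ∷ b ∷ c ∷ vs) =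
    A a c < A a b ⊓ A c b × ChordlessList A (b ∷ c ∷ vs)
  ChordlessList A _ = ⊤

  WeightedChordless : Matrix n → Walk (Fin n) → Set
  WeightedChordless A W = ChordlessList A (vertices W)

  record Critical (A : Matrix n) (W : Walk (Fin n)) : Set where
    field
      closed     : Closed W
      chordless  : WeightedChordless A W
      simplicial : Simplicial A (start W)
      minimum    : ∃[ u ] I[ W ] u × A (start W) u ≃min A

{-# OPTIONS --safe #-}
module Submission where

-- For C ⊆ V, C ≠ ∅, one shows by induction on V that A[V] has a simplicial point in C or a
-- chordless walk with end points in V ∖ C and all internal points, at least one, in C. Let m be
-- the least entry A c x with c ∈ C, x ∈ V, and call points adjacent when their entry exceeds m.
--
-- If A c s = m for some c ∈ C, s ∉ C, use V ∖ {s} and the non-neighbours of s in C: a simplicial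
-- point u there stays simplicial unless some (s, u, z) is a walk as required, and a walk ending
-- at a neighbour of s in C is prolonged to s.
--
-- Otherwise let X ⊆ C be a maximal connected set with some point far from it, i.e. outside X
-- and not adjacent to X; let T be the neighbours of X and D the far points. By maximality D is
-- completely joined to T. Apply induction to (X ∪ T, X) and (D ∪ T, D). A walk from T to T
-- through D closes up through X at any prescribed point of X, and vice versa; so two such walks
-- become a self-contained pair, one walk and a simplicial point give a critical walk, and two
-- simplicial points u, v have A u v = m. For V = C this is the theorem.

open import Defs
open import Axiom.ExcludedMiddle using (ExcludedMiddle)
open import Data.Nat.Base as ℕ using (ℕ)
open import Data.Product.Base using (_×_; ∃-syntax)
open import Data.Sum.Base using (_⊎_)
open import Level using (0ℓ)
open import Relation.Binary.PropositionalEquality using (_≢_)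
open import Relation.Nullary using (¬_)

open import Data.Bool.Base using (true)
open import Data.Empty using (⊥; ⊥-elim)
open import Data.Fin.Base using (Fin; zero; suc)
import Data.Fin.Subset as Subset
import Data.Fin.Subset.Induction as Subset
open import Data.List.Base using (List; []; _∷_; [_]; _++_; reverse; reverseAcc; allFin; cartesianProduct)
open import Data.List.Membership.Propositional using (_∈_)
open import Data.List.Membership.Propositional.Properties
  using (∈-++⁺ˡ; ∈-++⁺ʳ; ∈-++⁻; ∈-allFin; ∈-cartesianProduct⁺)
open import Data.List.Properties using (++-assoc; reverse-++; unfold-reverse)
open import Data.List.Relation.Unary.All as All using (All; []; _∷_)
import Data.List.Relation.Unary.All.Properties as All
open import Data.List.Relation.Unary.Any using (here; there)
import Data.List.Relation.Unary.Any.Properties as Any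
open import Data.Product.Base using (_,_; proj₁; proj₂; ∃; ∃₂)
import Data.Rational.Properties as ℚ
open import Data.Sum.Base using (inj₁; inj₂; [_,_]′)
open import Data.Unit.Base using (⊤; tt)
open import Data.Vec.Base using (tabulate)
open import Data.Vec.Properties using ([]=⇒lookup; lookup⇒[]=; lookup∘tabulate)
open import Function.Base using (_∘_; id; case_of_)
open import Induction.WellFounded using (WellFounded; Acc; acc; module Subrelation)
open import Relation.Binary.Definitions using (tri<; tri≈; tri>)
open import Relation.Binary.Bundles using (TotalPreorder)
open import Relation.Binary.Construct.Closure.ReflexiveTransitive using (Star; ε; _◅_; _◅◅_; gmap)
import Relation.Binary.Construct.On as On
open import Relation.Binary.PropositionalEquality
  using (_≡_; refl; sym; trans; cong; subst; ≢-sym)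
open import Relation.Nullary using (Dec; yes; no; does; contradiction)
open import Relation.Nullary.Decidable using (dec-true; decidable-stable)
open import Relation.Unary using (Pred; U; ∁; _∪_; _∩_; _⊆_; _⊂_)

-- Reversal of lists

all-reverse : ∀ {I : Set} {P : Pred I 0ℓ} {xs} → All P xs → All P (reverse xs)
all-reverse pxs = All.tabulate (All.lookup pxs ∘ Any.reverse⁻)

reverse-ends : ∀ {I : Set} (x : I) p vs y →
               reverse (x ∷ p ++ vs ++ [ y ]) ≡ y ∷ reverse vs ++ reverse p ++ [ x ]
reverse-ends x p vs y
  rewrite unfold-reverse x (p ++ vs ++ [ y ]) | reverse-++ p (vs ++ [ y ]) | reverse-++ vs [ y ]
  = cong (y ∷_) (++-assoc (reverse vs) (reverse p) [ x ])

++-assoc₄ : ∀ {I : Set} (ws xs ys zs : List I) → ws ++ xs ++ ys ++ zs ≡ (ws ++ xs ++ ys) ++ zs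
++-assoc₄ ws xs ys zs rewrite ++-assoc ws (xs ++ ys) zs | ++-assoc xs ys zs = refl

-- Strict inclusion of predicates on a finite type

module FiniteSets (em : ExcludedMiddle 0ℓ) {n : ℕ} where

  toSubset : Pred (Fin n) 0ℓ → Subset.Subset n
  toSubset P = tabulate λ x → does (em {P x})

  ∈-toSubset⁺ : ∀ P {x} → P x → x Subset.∈ toSubset P
  ∈-toSubset⁺ P {x} Px =
    lookup⇒[]= x _ (trans (lookup∘tabulate _ x) (dec-true em Px))

  ∈-toSubset⁻ : ∀ P {x} → x Subset.∈ toSubset P → P x
  ∈-toSubset⁻ P {x} x∈ = witness em (trans (sym (lookup∘tabulate _ x)) ([]=⇒lookup x∈))
    where
    witness : ∀ {Q : Set} (Q? : Dec Q) → does Q? ≡ true → Q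
    witness (yes q) _ = q

  toSubset-⊂ : ∀ {P Q} → P ⊂ Q → toSubset P Subset.⊂ toSubset Q
  toSubset-⊂ {P} {Q} (P⊆Q , Q⊈P) =
      (λ x∈ → ∈-toSubset⁺ Q (P⊆Q (∈-toSubset⁻ P x∈)))
    , decidable-stable em λ none →
        Q⊈P λ {x} Qx → decidable-stable em λ ¬Px →
          none (x , ∈-toSubset⁺ Q Qx , ¬Px ∘ ∈-toSubset⁻ P)

  ⊂-wellFounded : WellFounded (_⊂_ {A = Fin n} {ℓ₁ = 0ℓ} {ℓ₂ = 0ℓ})
  ⊂-wellFounded =
    Subrelation.wellFounded toSubset-⊂ (On.wellFounded toSubset Subset.⊂-wellFounded)

module _ (em : ExcludedMiddle 0ℓ) {c ℓ} (R : TotalPreorder c ℓ 0ℓ) where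
  open TotalPreorder R using (Carrier; _≲_; total) renaming (refl to ≲-refl; trans to ≲-trans)

  minimiser : ∀ {I : Set} (P : Pred I 0ℓ) (f : I → Carrier) xs →
              (∀ {x} → x ∈ xs → ¬ P x) ⊎
              ∃[ y ] P y × (∀ {x} → x ∈ xs → P x → f y ≲ f x)
  minimiser P f [] = inj₁ λ ()
  minimiser P f (x ∷ xs) with em {P x} | minimiser P f xs
  ... | no ¬Px | inj₁ none = inj₁ λ { (here refl) → ¬Px ; (there x∈) → none x∈ }
  ... | no ¬Px | inj₂ (y , Py , min) = inj₂ (y , Py , λ
    { (here refl) Px → contradiction Px ¬Px ; (there x∈) Px → min x∈ Px })
  ... | yes Px | inj₁ none = inj₂ (x , Px , λ
    { (here refl) _ → ≲-refl ; (there x∈) Px → contradiction Px (none x∈) })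
  ... | yes Px | inj₂ (y , Py , min) with total (f x) (f y)
  ...   | inj₁ fx≲fy = inj₂ (x , Px , λ
    { (here refl) _ → ≲-refl ; (there x∈) Pz → ≲-trans fx≲fy (min x∈ Pz) })
  ...   | inj₂ fy≲fx = inj₂ (y , Py , λ
    { (here refl) _ → fy≲fx ; (there x∈) Pz → min x∈ Pz })

-- Chordless lists over a total preorder

module Elimination
  (em : ExcludedMiddle 0ℓ) {c ℓ} (R : TotalPreorder c ℓ 0ℓ)
  {n : ℕ} (A : Fin n → Fin n → TotalPreorder.Carrier R)
  (A-sym : ∀ x y → TotalPreorder._≲_ R (A x y) (A y x))
  where

  open TotalPreorder R using (Carrier; _≲_; total) renaming (refl to ≲-refl; trans to ≲-trans)
  open FiniteSets em {n}

  infix 4 _≺_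
  -- For cuts, `≰⇒>` turns this negation back into `<`.
  _≺_ : Carrier → Carrier → Set
  x ≺ y = ¬ (y ≲ x)

  ≺⇒≲ : ∀ {x y} → x ≺ y → x ≲ y
  ≺⇒≲ {x} {y} x≺y = [ id , (λ y≲x → contradiction y≲x x≺y) ]′ (total x y)

  ≲-≺-trans : ∀ {x y z} → x ≲ y → y ≺ z → x ≺ z
  ≲-≺-trans x≲y y≺z z≲x = y≺z (≲-trans z≲x x≲y)

  ≺-≲-trans : ∀ {x y z} → x ≺ y → y ≲ z → x ≺ z
  ≺-≲-trans x≺y y≲z z≲x = x≺y (≲-trans y≲z z≲x)

  ≺-sym : ∀ {m x y} → m ≺ A x y → m ≺ A y x
  ≺-sym {x = x} {y} m≺ = ≺-≲-trans m≺ (A-sym x y)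

  ≲-sym : ∀ {m x y} → A x y ≲ m → A y x ≲ m
  ≲-sym {x = x} {y} = ≲-trans (A-sym y x)

  -- The condition a ≢ c keeps the unconstrained diagonal of A out of play.
  Triple : Fin n → Fin n → Fin n → Set
  Triple x y z = x ≢ z × A x z ≺ A x y × A x z ≺ A y z

  triple-sym : ∀ {x y z} → Triple x y z → Triple z y x
  triple-sym (x≢z , p , q) =
    ≢-sym x≢z , ≲-≺-trans (A-sym _ _) (≺-sym q) , ≲-≺-trans (A-sym _ _) (≺-sym p)

  triple : ∀ {m x y z} → x ≢ z → A x z ≲ m → m ≺ A x y → m ≺ A y z → Triple x y z
  triple x≢z p q r = x≢z , ≲-≺-trans p q , ≲-≺-trans p r

  Chordless : List (Fin n) → Set
  Chordless (x ∷ y ∷ z ∷ vs) = Triple x y z × Chordless (y ∷ z ∷ vs)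
  Chordless _                = ⊤

  chordless-reverse : ∀ vs → Chordless vs → Chordless (reverse vs)
  chordless-reverse []           _ = tt
  chordless-reverse (_ ∷ [])     _ = tt
  chordless-reverse (x ∷ y ∷ vs) g = go x y vs [] tt g
    where
    -- The reversed part and the remaining part share the two points `x` and `y`, so whole triples
    -- pass from one to the other.
    go : ∀ x y vs ws → Chordless (y ∷ x ∷ ws) → Chordless (x ∷ y ∷ vs) →
         Chordless (reverseAcc (y ∷ x ∷ ws) vs)
    go x y []       ws h _       = h
    go x y (z ∷ vs) ws h (t , g) = go y z vs (x ∷ ws) (triple-sym t , h) g

  least-entry : ∀ (P : Fin n → Fin n → Set) → (∀ {x y} → ¬ P x y) ⊎
                (∃₂ λ x y → P x y × (∀ {x′ y′} → P x′ y′ → A x y ≲ A x′ y′))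
  least-entry P with minimiser em R (λ (x , y) → P x y) (λ (x , y) → A x y)
                       (cartesianProduct (allFin n) (allFin n))
  ... | inj₁ none = inj₁ λ {x} {y} → none (∈-cartesianProduct⁺ (∈-allFin x) (∈-allFin y))
  ... | inj₂ ((x , y) , Pxy , min) =
    inj₂ (x , y , Pxy , λ {x′} {y′} → min (∈-cartesianProduct⁺ (∈-allFin x′) (∈-allFin y′)))

  -- `nonempty` excludes lists of two points, which are vacuously chordless. With `_≡ x` for `S` the
  -- path is closed at `x`.
  record Path (S K : Pred (Fin n) 0ℓ) : Set where
    field
      {first last} : Fin n
      {inner}      : List (Fin n)
      first∈       : S first
      last∈        : S last
      inner∈       : All K inner
      nonempty     : ∃ (_∈ inner)
      chordless    : Chordless (first ∷ inner ++ [ last ])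

  open Path

  map-ends : ∀ {S S′ K} → S ⊆ S′ → Path S K → Path S′ K
  map-ends S⊆S′ P = record
    { first∈ = S⊆S′ (first∈ P) ; last∈ = S⊆S′ (last∈ P) ; inner∈ = inner∈ P
    ; nonempty = nonempty P ; chordless = chordless P }

  -- A chordless list starting at a point of S and then entering K can be made to start in S′,
  -- by inserting a list of points of K′. Points of the list beyond K are only known to lie in W.
  Reroutable : (W S K S′ K′ : Pred (Fin n) 0ℓ) → Set
  Reroutable W S K S′ K′ =
    ∀ {a k z zs} → S a → K k → W z → Chordless (a ∷ k ∷ z ∷ zs) →
    ∃₂ λ s p → S′ s × All K′ p × Chordless (s ∷ p ++ k ∷ z ∷ zs)

  -- The third point that `f` asks for is the second of `vs` or, if `vs` has only one, the first of
  -- `zs`.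
  reroute-first : ∀ {W S K S′ K′} → Reroutable W S K S′ K′ → K ⊆ W →
                  ∀ {a vs zs} → S a → All K vs → ∃ (_∈ vs) → All W zs → ∃ (_∈ zs) →
                  Chordless (a ∷ vs ++ zs) →
                  ∃₂ λ s p → S′ s × All K′ p × Chordless (s ∷ p ++ vs ++ zs)
  reroute-first f K⊆W Sa (Kk ∷ [])      _ (Wz ∷ _) _ g = f Sa Kk Wz g
  reroute-first f K⊆W Sa (Kk ∷ Kk′ ∷ _) _ _        _ g = f Sa Kk (K⊆W Kk′) g
  reroute-first _ _   _  []    (_ , ())
  reroute-first _ _   _  (_ ∷ []) _ [] (_ , ())

  -- One end is repaired, the list is reversed, and the other end is repaired likewise. Tracking the
  -- old inner points later shows that a closed path meets a given point.
  reroute : ∀ {W S K S′ K′} → Reroutable W S K S′ K′ →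
            S ⊆ W → S′ ⊆ W → K ⊆ K′ → K′ ⊆ W → (P : Path S K) →
            ∃[ Q ] (∀ {x} → x ∈ inner P → x ∈ inner {S′} {K′} Q)
  reroute f S⊆W S′⊆W K⊆K′ K′⊆W P
    with s , p , S′s , K′p , g ←
           reroute-first f (K′⊆W ∘ K⊆K′) (first∈ P) (inner∈ P) (nonempty P)
             (S⊆W (last∈ P) ∷ []) (_ , here refl) (chordless P)
    with t , q , S′t , K′q , h ←
           reroute-first f (K′⊆W ∘ K⊆K′) (last∈ P) (all-reverse (inner∈ P))
             (_ , Any.reverse⁺ (proj₂ (nonempty P)))
             (All.++⁺ (all-reverse (All.map K′⊆W K′p)) (S′⊆W S′s ∷ []))
             (_ , ∈-++⁺ʳ (reverse p) (here refl))
             (subst Chordless (reverse-ends s p (inner P) (last P)) (chordless-reverse _ g))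
    = record
      { first∈    = S′t
      ; last∈     = S′s
      ; inner∈    = All.++⁺ K′q (All.++⁺ (all-reverse (All.map K⊆K′ (inner∈ P))) (all-reverse K′p))
      ; nonempty  = _ , included (proj₂ (nonempty P))
      ; chordless = subst Chordless (cong (t ∷_) (++-assoc₄ q (reverse (inner P)) (reverse p) [ s ])) h
      } , included
    where
    included : ∀ {x} → x ∈ inner P → x ∈ q ++ reverse (inner P) ++ reverse p
    included x∈ = ∈-++⁺ʳ q (∈-++⁺ˡ (Any.reverse⁺ x∈))

  -- By totality, lying above the smaller of two entries is lying above one of them; the disjunction
  -- says this without a meet.
  SimplicialIn : Pred (Fin n) 0ℓ → Fin n → Set
  SimplicialIn V u =
    ∀ y z → V y → V z → y ≢ u → z ≢ u → y ≢ z → A u y ≲ A y z ⊎ A u z ≲ A y z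

  Solution : (V C : Pred (Fin n) 0ℓ) → Set
  Solution V C = (∃[ u ] C u × SimplicialIn V u) ⊎ Path (V ∩ ∁ C) C

  Solvable : Pred (Fin n) 0ℓ → Set₁
  Solvable V = ∀ C → C ⊆ V → ∃ C → Solution V C

  -- Only pairs with a point outside `V′` are new, and by symmetry of `A` that point may be called
  -- `y`.
  simplicial-extend : ∀ {V V′ u} → SimplicialIn V′ u →
                      (∀ {y z} → V y → ¬ V′ y → V z → y ≢ u → z ≢ u → y ≢ z →
                        A u y ≲ A y z ⊎ A u z ≲ A y z) →
                      SimplicialIn V u
  simplicial-extend {V′ = V′} simp new y z Vy Vz y≢u z≢u y≢z with em {V′ y} | em {V′ z}
  ... | yes V′y | yes V′z = simp y z V′y V′z y≢u z≢u y≢z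
  ... | no ¬V′y | _       = new Vy ¬V′y Vz y≢u z≢u y≢z
  ... | yes _   | no ¬V′z with new Vz ¬V′z Vy z≢u y≢u (≢-sym y≢z)
  ...   | inj₁ p = inj₂ (≲-trans p (A-sym z y))
  ...   | inj₂ p = inj₁ (≲-trans p (A-sym z y))

  -- Separating `C` along the entries above `m`

  module Split
    {V C : Pred (Fin n) 0ℓ} (C⊆V : C ⊆ V) {m : Carrier}
    (m-min : ∀ {c x} → C c → V x → x ≢ c → m ≲ A c x)
    (m-outside : ∀ {s c} → V s → ¬ C s → C c → m ≺ A s c)
    where

    module _ (X : Pred (Fin n) 0ℓ) where

      Boundary : Pred (Fin n) 0ℓ
      Boundary t = V t × ¬ X t × ∃[ x ] X x × m ≺ A t x

      Far : Pred (Fin n) 0ℓ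
      Far d = C d × ¬ X d × (∀ {x} → X x → A d x ≲ m)

      -- Every point of the walk but the last is the source of a step, and the last is `y`; so the
      -- walk stays in `X`.
      Connected : Set
      Connected = ∀ {x y} → X x → X y → Star (λ u v → X u × m ≺ A u v) x y

    record Separation : Set₁ where
      field
        X         : Pred (Fin n) 0ℓ
        X⊆C       : X ⊆ C
        connected : Connected X
        inhabited : ∃ X
        far       : ∃ (Far X)
        complete  : ∀ {t d} → Boundary X t → Far X d → m ≺ A t d

    -- A maximal connected set with a far point works: if a boundary point t were
    -- non-adjacent to a far point d, then d would still be far from X ∪ {t}.
    separate : ∀ X → Acc _⊂_ (∁ X) → X ⊆ C → Connected X → ∃ X → ∃ (Far X) → Separation
    separate X (acc rec) X⊆C conn (x₀ , Xx₀) far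
      with em {∃₂ λ t d → Boundary X t × Far X d × A t d ≲ m}
    ... | no none = record
      { X = X ; X⊆C = X⊆C ; connected = conn ; inhabited = x₀ , Xx₀ ; far = far
      ; complete = λ Tt Dd p → none (_ , _ , Tt , Dd , p) }
    ... | yes (t , d , (Vt , ¬Xt , y , Xy , m≺ty) , (Cd , ¬Xd , d-far) , td≲m) =
      separate X′ (rec smaller) X′⊆C conn′ (x₀ , inj₁ Xx₀) (d , Cd , ¬X′d , d-far′)
      where
      X′ : Pred (Fin n) 0ℓ
      X′ = X ∪ (_≡ t)

      smaller : ∁ X′ ⊂ ∁ X
      smaller = (λ ¬X′x Xx → ¬X′x (inj₁ Xx)) , λ sub → sub ¬Xt (inj₂ refl)

      X′⊆C : X′ ⊆ C
      X′⊆C (inj₁ Xx)   = X⊆C Xx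
      X′⊆C (inj₂ refl) = decidable-stable em λ ¬Ct → m-outside Vt ¬Ct Cd td≲m

      conn′ : Connected X′
      conn′ (inj₁ Xx)   (inj₁ Xz)   = gmap id (λ (Xu , e) → inj₁ Xu , e) (conn Xx Xz)
      conn′ (inj₁ Xx)   (inj₂ refl) = conn′ (inj₁ Xx) (inj₁ Xy) ◅◅ (inj₁ Xy , ≺-sym m≺ty) ◅ ε
      conn′ (inj₂ refl) (inj₁ Xz)   = (inj₂ refl , m≺ty) ◅ conn′ (inj₁ Xy) (inj₁ Xz)
      conn′ (inj₂ refl) (inj₂ refl) = ε

      ¬X′d : ¬ X′ d
      ¬X′d (inj₁ Xd)   = ¬Xd Xd
      ¬X′d (inj₂ refl) = m≺ty (d-far Xy)

      d-far′ : ∀ {x} → X′ x → A d x ≲ m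
      d-far′ (inj₁ Xx)   = d-far Xx
      d-far′ (inj₂ refl) = ≲-sym td≲m

    separation : ∀ {c x} → C c → C x → x ≢ c → A c x ≲ m → Separation
    separation {c} {x} Cc Cx x≢c cx≲m =
      separate (_≡ x) (⊂-wellFounded _) (λ { refl → Cx }) (λ { refl refl → ε })
        (x , refl) (c , Cc , ≢-sym x≢c , λ { refl → cx≲m })

    -- In the second case `P` is closed at `u` and becomes the critical walk. The induction keeps
    -- only `u`.
    SplitResult : Set
    SplitResult =
      (∃₂ λ u v → u ≢ v × C u × SimplicialIn V u × SimplicialIn V v × A u v ≲ m) ⊎
      (∃[ u ] C u × SimplicialIn V u ×
        ∃[ P ] ∃[ x ] x ∈ inner {_≡ u} {V} P × u ≢ x × A u x ≲ m)

    -- The two sides of a separation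

    module _
      (no-linked-paths : ∀ {x y K} (P : Path (_≡ x) K) (Q : Path (_≡ y) K) →
                         y ∈ inner P → x ∈ inner Q → ⊥)
      (solve : ∀ {V′} → V′ ⊂ V → Solvable V′)
      (sep : Separation)
      where
      open Separation sep

      T D : Pred (Fin n) 0ℓ
      T = Boundary X
      D = Far X

      D≢X : ∀ {d x} → D d → X x → d ≢ x
      D≢X (_ , ¬Xd , _) Xx refl = ¬Xd Xx

      -- A point outside `C` is adjacent to all of `X` by `m-outside`, so a point outside `X`
      -- without neighbours in `X` lies in `C` and is far.
      cover : ∀ {v} → V v → (X ∪ T) v ⊎ D v
      cover {v} Vv with em {X v} | em {∃[ x ] X x × m ≺ A v x}
      ... | yes Xv | _        = inj₁ (inj₁ Xv)
      ... | no ¬Xv | yes near = inj₁ (inj₂ (Vv , ¬Xv , near))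
      ... | no ¬Xv | no ¬near = inj₂ (Cv , ¬Xv , v-far)
        where
        v-far : ∀ {x} → X x → A v x ≲ m
        v-far Xx = decidable-stable em λ m≺ → ¬near (_ , Xx , m≺)

        Cv : C v
        Cv = decidable-stable em λ ¬Cv →
          let x , Xx = inhabited in ¬near (x , Xx , m-outside Vv ¬Cv (X⊆C Xx))

      -- Serves both sides, with `X` and `D` exchanged. A point of `V` outside `Y ∪ T` lies in `Z`:
      -- its entry with `u` is at most `m`, hence at most its other entries, and `u` stays
      -- simplicial.
      side : ∀ (Y Z : Pred (Fin n) 0ℓ) → Y ⊆ C → Z ⊆ C → (∀ {v} → V v → (Y ∪ T) v ⊎ Z v) →
             (∀ {y z} → Y y → Z z → A y z ≲ m) →
             ∃ Y → (∃[ z ] Z z × ¬ (Y ∪ T) z) →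
             (∃[ u ] Y u × SimplicialIn V u) ⊎ Path T Y
      side Y Z Y⊆C Z⊆C covers apart ∃Y (z , Zz , z∉) with solve V′⊂V Y inj₁ ∃Y
        where
        V′⊂V : (Y ∪ T) ⊂ V
        V′⊂V = [ C⊆V ∘ Y⊆C , proj₁ ]′ , λ V⊆ → z∉ (V⊆ (C⊆V (Z⊆C Zz)))
      ... | inj₂ P = inj₂ (map-ends
        (λ { (inj₁ Yv , ¬Yv) → contradiction Yv ¬Yv ; (inj₂ Tv , _) → Tv }) P)
      ... | inj₁ (u , Yu , simp) = inj₁ (u , Yu , simplicial-extend simp λ Vy y∉ Vz _ _ y≢z →
        case covers Vy of λ
          { (inj₁ y∈) → contradiction y∈ y∉
          ; (inj₂ Zy) → inj₁ (≲-trans (apart Yu Zy) (m-min (Z⊆C Zy) Vz (≢-sym y≢z))) })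

      side-X : (∃[ u ] X u × SimplicialIn V u) ⊎ Path T X
      side-X = side X D X⊆C proj₁ cover (λ Xx Dd → ≲-sym (proj₂ (proj₂ Dd) Xx)) inhabited
        (let d , Dd = far in d , Dd , λ
          { (inj₁ Xd) → proj₁ (proj₂ Dd) Xd
          ; (inj₂ (_ , _ , x , Xx , m≺)) → m≺ (proj₂ (proj₂ Dd) Xx) })

      side-D : (∃[ u ] D u × SimplicialIn V u) ⊎ Path T D
      side-D = side D X proj₁ X⊆C
        (λ Vv → case cover Vv of λ
          { (inj₁ (inj₁ Xv)) → inj₂ Xv
          ; (inj₁ (inj₂ Tv)) → inj₁ (inj₂ Tv)
          ; (inj₂ Dv)        → inj₁ (inj₁ Dv) })
        (λ Dd Xx → proj₂ (proj₂ Dd) Xx) far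
        (let x , Xx = inhabited in x , Xx , λ
          { (inj₁ Dx) → proj₁ (proj₂ Dx) Xx ; (inj₂ Tx) → proj₁ (proj₂ Tx) Xx })

      -- `d` is joined to `t` by `complete` and far from `k`, so it can be put in front of `t`.
      from-D : ∀ {d} → D d → Reroutable V T X (_≡ d) V
      from-D {d} Dd {t} {k} {z} Tt Xk Vz (ttz , g) =
        d , [ t ] , refl , proj₁ Tt ∷ [] ,
        triple (D≢X Dd Xk) (proj₂ (proj₂ Dd) Xk) (≺-sym (complete Tt Dd)) m≺tk , ttz , g
        where
        m≺tk : m ≺ A t k
        m≺tk with em {C t}
        ... | no ¬Ct = m-outside (proj₁ Tt) ¬Ct (X⊆C Xk)
        -- The triple at `k` puts `A t k` strictly above `A t z`, which is at least `m` because `t`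
        -- is in `C`.
        ... | yes Ct = ≲-≺-trans (m-min Ct Vz (≢-sym (proj₁ ttz))) (proj₁ (proj₂ ttz))

      module _ {t : Fin n} (Tt : T t) where

        head-or-t : List (Fin n) → Fin n
        head-or-t []      = t
        head-or-t (x ∷ _) = x

        -- Trail x q says that x ∷ q lies in X and that x ∷ q ++ [ t ] is a walk in the graph
        -- A > m, without edges or coincidences between points two steps apart.
        data Trail : Fin n → List (Fin n) → Set where
          final : ∀ {x} → X x → m ≺ A x t → Trail x []
          step  : ∀ {x y q} → X x → m ≺ A x y → x ≢ head-or-t q → A x (head-or-t q) ≲ m →
                  Trail y q → Trail x (y ∷ q)

        trail-edge : ∀ {x q} → Trail x q → m ≺ A x (head-or-t q)
        trail-edge (final _ e)      = e
        trail-edge (step _ e _ _ _) = e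

        trail-⊆X : ∀ {x q} → Trail x q → All X (x ∷ q)
        trail-⊆X (final Xx _)        = Xx ∷ []
        trail-⊆X (step Xx _ _ _ rest) = Xx ∷ trail-⊆X rest

        -- Shortening to an induced path: if `x` is adjacent to the point after `y`, then `y` is
        -- skipped; if `x` is that point, its own trail is taken.
        push : ∀ {x y q} → X x → m ≺ A x y → Trail y q → ∃ (Trail x)
        push {x} {q = q} Xx m≺xy tr with em {m ≺ A x (head-or-t q)} | em {x ≡ head-or-t q}
        push Xx m≺xy (final _ _)       | yes e | _ = [] , final Xx e
        push Xx m≺xy (step _ _ _ _ tr) | yes e | _ = push Xx e tr
        push Xx m≺xy (final _ _)       | no _  | yes refl = contradiction Xx (proj₁ (proj₂ Tt))
        push Xx m≺xy (step _ _ _ _ tr) | no _  | yes refl = _ , tr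
        push Xx m≺xy tr                | no ¬e | no x≢ = _ , step Xx m≺xy x≢ (decidable-stable em ¬e) tr

        trail : ∀ {x y} → Star (λ u v → X u × m ≺ A u v) x y → X y → m ≺ A y t → ∃ (Trail x)
        trail ε                Xy e = [] , final Xy e
        trail ((Xx , e′) ◅ es) Xy e = push Xx e′ (proj₂ (trail es Xy e))

        trail-chordless : ∀ {d zs} → D d → Chordless (t ∷ d ∷ zs) → ∀ {x q} → Trail x q →
                          Chordless (x ∷ q ++ t ∷ d ∷ zs)
        trail-chordless Dd g (final Xx e) =
          triple (≢-sym (D≢X Dd Xx)) (≲-sym (proj₂ (proj₂ Dd) Xx)) e (complete Tt Dd) , g
        trail-chordless Dd g (step {q = []} _ e x≢ xt≲m tr) =
          triple x≢ xt≲m e (trail-edge tr) , trail-chordless Dd g tr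
        trail-chordless Dd g (step {q = _ ∷ _} _ e x≢ xz≲m tr) =
          triple x≢ xz≲m e (trail-edge tr) , trail-chordless Dd g tr

      -- A boundary point has a neighbour in `X`, which connectedness links to any prescribed `x`.
      from-X : ∀ {x} → X x → Reroutable V T D (_≡ x) V
      from-X {x} Xx {t} {d} {z} {zs} Tt@(Vt , _ , y , Xy , m≺ty) Dd _ g
        with q , tr ← trail Tt (connected Xx Xy) Xy (≺-sym m≺ty) =
          x , q ++ [ t ] , refl
          , All.++⁺ (All.map (C⊆V ∘ X⊆C) (All.tail (trail-⊆X Tt tr))) (Vt ∷ [])
          , subst Chordless (cong (x ∷_) (sym (++-assoc q [ t ] (d ∷ z ∷ zs))))
              (trail-chordless Tt Dd g tr)

      close-X : ∀ {x} → X x → (P : Path T D) → ∃[ Q ] (∀ {v} → v ∈ inner P → v ∈ inner {_≡ x} {V} Q)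
      close-X Xx = reroute (from-X Xx) proj₁ (λ { refl → C⊆V (X⊆C Xx) }) (C⊆V ∘ proj₁) id

      close-D : ∀ {d} → D d → (P : Path T X) → ∃[ Q ] (∀ {v} → v ∈ inner P → v ∈ inner {_≡ d} {V} Q)
      close-D Dd = reroute (from-D Dd) proj₁ (λ { refl → C⊆V (proj₁ Dd) }) (C⊆V ∘ X⊆C) id

      split : SplitResult
      split with side-X | side-D
      ... | inj₁ (u , Xu , u-simp) | inj₁ (v , Dv , v-simp) =
        inj₁ (v , u , D≢X Dv Xu , proj₁ Dv , v-simp , u-simp , proj₂ (proj₂ Dv) Xu)
      ... | inj₁ (u , Xu , u-simp) | inj₂ P =
        let Q , P⊆Q = close-X Xu P ; d , d∈ = nonempty P ; Dd = All.lookup (inner∈ P) d∈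
        in inj₂ (u , X⊆C Xu , u-simp , Q , d , P⊆Q d∈ , ≢-sym (D≢X Dd Xu) , ≲-sym (proj₂ (proj₂ Dd) Xu))
      ... | inj₂ P | inj₁ (v , Dv , v-simp) =
        let Q , P⊆Q = close-D Dv P ; x , x∈ = nonempty P ; Xx = All.lookup (inner∈ P) x∈
        in inj₂ (v , proj₁ Dv , v-simp , Q , x , P⊆Q x∈ , D≢X Dv Xx , proj₂ (proj₂ Dv) Xx)
      ... | inj₂ P | inj₂ P′ =
        -- Each path is closed at an inner point of the other.
        let x , x∈ = nonempty P  ; Xx = All.lookup (inner∈ P) x∈
            d , d∈ = nonempty P′ ; Dd = All.lookup (inner∈ P′) d∈
            Q  , P⊆Q   = close-D Dd P
            Q′ , P′⊆Q′ = close-X Xx P′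
        in ⊥-elim (no-linked-paths Q Q′ (P⊆Q x∈) (P′⊆Q′ d∈))


  -- The induction on `V`

  module _
    (no-linked-paths : ∀ {x y} {K : Pred (Fin n) 0ℓ} (P : Path (_≡ x) K) (Q : Path (_≡ y) K) →
                       y ∈ inner P → x ∈ inner Q → ⊥)
    where

    solve : ∀ V → Acc _⊂_ V → Solvable V
    solve V (acc rec) C C⊆V (c₀ , Cc₀) with em {Path (V ∩ ∁ C) C}
    ... | yes P = inj₂ P
    ... | no ¬P with least-entry (λ c x → C c × V x × x ≢ c)
    -- Only a one-point `V` has no such entry; `c₀` is then vacuously simplicial.
    ...   | inj₁ none = inj₁ (c₀ , Cc₀ , λ _ _ Vy _ y≢ _ _ → contradiction (Cc₀ , Vy , y≢) none)
    ...   | inj₂ (c₁ , x₁ , (Cc₁ , Vx₁ , x₁≢c₁) , min) = inj₁ simplicial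
      where
      m : Carrier
      m = A c₁ x₁

      m-min : ∀ {c x} → C c → V x → x ≢ c → m ≲ A c x
      m-min Cc Vx x≢c = min (Cc , Vx , x≢c)

      module DeletePoint {s c} (Vs : V s) (¬Cs : ¬ C s) (Cc : C c) (cs≲m : A c s ≲ m) where

        V′ C′ : Pred (Fin n) 0ℓ
        V′ x = V x × x ≢ s
        C′ x = C x × A x s ≲ m

        C≢s : ∀ {x} → C x → x ≢ s
        C≢s Cx refl = ¬Cs Cx

        -- An end in `C` but not in `C′` is a neighbour of `s`, while `k` is not, so `s` goes in
        -- front. `A a k` exceeds `m` because the triple at `k` puts it above `A a z`.
        from-s : Reroutable V (V′ ∩ ∁ C′) C′ (V ∩ ∁ C) C
        from-s {a} {k} ((Va , a≢s) , ¬C′a) (Ck , ks≲m) Vz (t , g) with em {C a}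
        ... | no ¬Ca = a , [] , (Va , ¬Ca) , [] , t , g
        ... | yes Ca = s , [ a ] , (Vs , ¬Cs) , Ca ∷ [] ,
          triple (≢-sym (C≢s Ck)) (≲-sym ks≲m) (≺-sym λ as≲m → ¬C′a (Ca , as≲m))
            (≲-≺-trans (m-min Ca Vz (≢-sym (proj₁ t))) (proj₁ (proj₂ t))) ,
          t , g

        -- For `z` in `C`, `A u s` is at most `m` and so at most `A s z`; for `z` outside, failure
        -- makes `s`, `u`, `z` a path against `¬P`.
        new-pair : ∀ {u z} → C′ u → V z → z ≢ u → s ≢ z → A u s ≲ A s z ⊎ A u z ≲ A s z
        new-pair {u} {z} (Cu , us≲m) Vz z≢u s≢z with em {C z} | em {A u s ≲ A s z} | em {A u z ≲ A s z}
        ... | yes Cz | _     | _     = inj₁ (≲-trans us≲m (≲-trans (m-min Cz Vs s≢z) (A-sym z s)))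
        ... | no _   | yes p | _     = inj₁ p
        ... | no _   | _     | yes q = inj₂ q
        ... | no ¬Cz | no p  | no q  = contradiction (record
          { first∈ = Vs , ¬Cs ; last∈ = Vz , ¬Cz ; inner∈ = Cu ∷ [] ; nonempty = _ , here refl
          ; chordless = (s≢z , ≺-sym p , q) , tt }) ¬P

        simplicial : ∃[ u ] C u × SimplicialIn V u
        simplicial with solve V′ (rec V′⊂V) C′ (λ (Cx , _) → C⊆V Cx , C≢s Cx) (c , Cc , cs≲m)
          where
          V′⊂V : V′ ⊂ V
          V′⊂V = proj₁ , λ V⊆V′ → proj₂ (V⊆V′ Vs) refl
        ... | inj₂ P = contradiction
          (proj₁ (reroute from-s (proj₁ ∘ proj₁) proj₁ proj₁ C⊆V P)) ¬P
        ... | inj₁ (u , C′u , simp) =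
          u , proj₁ C′u , simplicial-extend simp λ {y} Vy ¬V′y Vz _ z≢u y≢z →
            case decidable-stable em (λ y≢s → ¬V′y (Vy , y≢s)) of λ
              { refl → new-pair C′u Vz z≢u y≢z }

      simplicial : ∃[ u ] C u × SimplicialIn V u
      simplicial with em {∃₂ λ s c → V s × ¬ C s × C c × A c s ≲ m}
      ... | yes (_ , _ , Vs , ¬Cs , Cc , cs≲m) = DeletePoint.simplicial Vs ¬Cs Cc cs≲m
      ... | no none = case outcome of λ
        { (inj₁ (u , _ , _ , Cu , u-simp , _)) → u , Cu , u-simp
        ; (inj₂ (u , Cu , u-simp , _)) → u , Cu , u-simp }
        where
        open Split C⊆V m-min (λ Vs ¬Cs Cc → ≺-sym λ cs≲m → none (_ , _ , Vs , ¬Cs , Cc , cs≲m))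

        Cx₁ : C x₁
        Cx₁ = decidable-stable em λ ¬Cx₁ → none (_ , _ , Vx₁ , ¬Cx₁ , Cc₁ , ≲-refl)

        outcome : SplitResult
        outcome = split no-linked-paths (λ {V′} V′⊂V → solve V′ (rec V′⊂V)) (separation Cc₁ Cx₁ x₁≢c₁ ≲-refl)

    -- With `C` all of `V` there are no outside points, so `split` applies at once. It is called
    -- directly because `solve` forgets the second simplicial point and the closed path.
    dichotomy : ∀ {x y} → x ≢ y → ∃[ m ] (∀ {x y} → x ≢ y → m ≲ A x y) × (
      (∃₂ λ u v → u ≢ v × SimplicialIn U u × SimplicialIn U v × A u v ≲ m) ⊎
      (∃[ u ] SimplicialIn U u × (∃[ P ] ∃[ x ] x ∈ inner {_≡ u} {U} P × u ≢ x × A u x ≲ m)))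
    dichotomy x≢y with least-entry _≢_
    ... | inj₁ none = contradiction x≢y none
    ... | inj₂ (x , y , x≢y , min) = A x y , min , (case outcome of λ
      { (inj₁ (u , v , u≢v , _ , p)) → inj₁ (u , v , u≢v , p)
      ; (inj₂ (u , _ , p)) → inj₂ (u , p) })
      where
      open Split {V = U} {C = U} id (λ _ _ x≢c → min (≢-sym x≢c)) (λ _ ¬U _ → contradiction tt ¬U)

      outcome : SplitResult
      outcome = split no-linked-paths (λ {V′} _ → solve V′ (⊂-wellFounded V′))
        (separation tt tt (≢-sym x≢y) ≲-refl)

-- Dedekind cuts as a total preorder

module Reals (em : ExcludedMiddle 0ℓ) where
  open ℝ

  -- Some `q` below `x` is not below `y`; openness gives a larger `r` still below `x`, and locating
  -- `y` between them leaves only `r` above `y`.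
  ≰⇒> : ∀ x y → ¬ (x ≤ y) → y < x
  ≰⇒> x y x≰y with em {∃[ q ] L x q × ¬ L y q}
  ... | no none = contradiction (λ {q} Lxq → decidable-stable em λ ¬Lyq → none (q , Lxq , ¬Lyq)) x≰y
  ... | yes (q , Lxq , ¬Lyq) with L-open x Lxq
  ...   | r , q<r , Lxr with located y q<r
  ...     | inj₁ Lyq = contradiction Lyq ¬Lyq
  ...     | inj₂ Uyr = r , Uyr , Lxr

  <⇒≤ : ∀ x y → x < y → x ≤ y
  <⇒≤ x y (q , Uxq , Lyq) {r} Lxr with ℚ.<-cmp r q
  ... | tri< r<q _ _ = L-lower y r<q Lyq
  ... | tri≈ _ refl _ = Lyq
  ... | tri> _ _ q<r = contradiction (Lxr , U-upper x q<r Uxq) (disjoint x)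

  <-⊓ : ∀ x y z → x < y → x < z → x < y ⊓ z
  <-⊓ x y z (q , Uxq , Lyq) (r , Uxr , Lzr) with ℚ.<-cmp q r
  ... | tri< q<r _ _  = q , Uxq , Lyq , L-lower z q<r Lzr
  ... | tri≈ _ refl _ = q , Uxq , Lyq , Lzr
  ... | tri> _ _ r<q  = r , Uxr , L-lower y r<q Lyq , Lzr

  ≤-total : ∀ x y → x ≤ y ⊎ y ≤ x
  ≤-total x y with em {x ≤ y}
  ... | yes x≤y = inj₁ x≤y
  ... | no x≰y  = inj₂ (<⇒≤ y x (≰⇒> x y x≰y))

  totalPreorder : TotalPreorder _ _ _
  totalPreorder = record
    { Carrier = ℝ
    ; _≈_ = _≃_
    ; _≲_ = _≤_
    ; isTotalPreorder = record
      { isPreorder = record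
        { isEquivalence = record
          { refl  = id , id
          ; sym   = λ (x≤y , y≤x) → y≤x , x≤y
          ; trans = λ (x≤y , y≤x) (y≤z , z≤y) → (λ p → y≤z (x≤y p)) , (λ p → y≤x (z≤y p)) }
        ; reflexive = proj₁
        ; trans = λ x≤y y≤z p → y≤z (x≤y p) }
      ; total = ≤-total
      }
    }

-- Transfer to real matrices

theorem4 : ExcludedMiddle 0ℓ →
    ∀ n → 2 ℕ.≤ n →
    (A : Matrix n) → Symmetric A →
    ¬ (∃[ W₁ ] ∃[ W₂ ] WeightedChordless A W₁ × WeightedChordless A W₂ × SelfContained W₁ W₂) →
    (∃[ W ] Critical A W) ⊎
    (∃[ u ] ∃[ v ] u ≢ v × Simplicial A u × Simplicial A v × A u v ≃min A)
theorem4 _  (ℕ.suc ℕ.zero) (ℕ.s≤s ())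
theorem4 em n@(ℕ.suc (ℕ.suc _)) _ A A-sym no-pair = result
  where
  open Reals em
  open Elimination em totalPreorder A (λ x y → proj₁ (A-sym x y))
  open Path

  weightedChordless : ∀ vs → Chordless vs → ChordlessList A vs
  weightedChordless (x ∷ y ∷ z ∷ vs) ((_ , p , q) , g) =
      <-⊓ (A x z) (A x y) (A z y)
        -- The weighted condition reads the second edge as `A z y`, hence the use of symmetry.
        (≰⇒> (A x y) (A x z) p) (≰⇒> (A z y) (A x z) (≺-sym {A x z} q))
    , weightedChordless (y ∷ z ∷ vs) g
  weightedChordless []          _ = tt
  weightedChordless (_ ∷ [])     _ = tt
  weightedChordless (_ ∷ _ ∷ []) _ = tt

  toWalk : ∀ {S K} → Path S K → Walk (Fin n)
  toWalk P = walk (first P) (inner P) (last P)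

  vertex : ∀ {x K} (P : Path (_≡ x) K) {z} → V[ toWalk P ] z → z ≡ x ⊎ I[ toWalk P ] z
  vertex P (here refl) = inj₁ (first∈ P)
  vertex P (there z∈)  with ∈-++⁻ (inner P) z∈
  ... | inj₁ z∈I         = inj₂ z∈I
  ... | inj₂ (here refl) = inj₁ (last∈ P)

  -- The only vertex of a closed walk that may fail to be internal is its end point, and here that
  -- is internal to the other walk.
  no-linked-paths : ∀ {x y} {K : Pred (Fin n) 0ℓ} (P : Path (_≡ x) K) (Q : Path (_≡ y) K) →
                    y ∈ inner P → x ∈ inner Q → ⊥
  no-linked-paths P Q y∈P x∈Q = no-pair
    ( toWalk P , toWalk Q
    , weightedChordless _ (chordless P) , weightedChordless _ (chordless Q)
    , [ (λ z∈ → [ (λ { refl → inj₂ x∈Q }) , inj₁ ]′ (vertex P z∈))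
      , (λ z∈ → [ (λ { refl → inj₁ y∈P }) , inj₂ ]′ (vertex Q z∈)) ]′
    , [ inj₁ ∘ there ∘ ∈-++⁺ˡ , inj₂ ∘ there ∘ ∈-++⁺ˡ ]′ )

  simplicial⁺ : ∀ {u} → SimplicialIn U u → Simplicial A u
  simplicial⁺ simp y z y≢u z≢u y≢z (Luy , Luz) =
    [ (λ p → p Luy) , (λ p → p Luz) ]′ (simp y z tt tt y≢u z≢u y≢z)

  minimum⁺ : ∀ {m u v} → (∀ {x y} → x ≢ y → m ≤ A x y) → u ≢ v → A u v ≤ m → A u v ≃min A
  minimum⁺ min u≢v uv≤m = (λ x y x≢y p → min x≢y (uv≤m p)) , _ , _ , u≢v , id , id

  result : (∃[ W ] Critical A W) ⊎
           (∃[ u ] ∃[ v ] u ≢ v × Simplicial A u × Simplicial A v × A u v ≃min A)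
  result with dichotomy no-linked-paths {zero} {suc zero} (λ ())
  ... | m , min , inj₁ (u , v , u≢v , u-simp , v-simp , uv≤m) =
    inj₂ (u , v , u≢v , simplicial⁺ u-simp , simplicial⁺ v-simp , minimum⁺ {m} min u≢v uv≤m)
  ... | m , min , inj₂ (u , u-simp , P , x , x∈P , u≢x , ux≤m) = inj₁ (toWalk P , record
    { closed     = trans (first∈ P) (sym (last∈ P))
    ; chordless  = weightedChordless _ (chordless P)
    ; simplicial = subst (Simplicial A) (sym (first∈ P)) (simplicial⁺ u-simp)
    ; minimum    =
        x , x∈P , subst (λ v → A v x ≃min A) (sym (first∈ P)) (minimum⁺ {m} min u≢x ux≤m) })
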